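{- Computability is stable over the structures $\langle\mathbb{N},S\rangle$ and $\langle\mathbb{N},+\rangle$, where $S$ is the successor function and $+$ is addition of natural numbers.
   Context: Computability over natural numbers is the usual one. A set $A \subseteq \mathbb{N}$ is effectively enumerable if it is empty or the image of a total computable function from $\mathbb{N}$ to $\mathbb{N}$. For $A \subseteq \mathbb{N}^m$ and $B \subseteq \mathbb{N}$, a computable function from $A$ to $B$ is a partial computable function that is defined at every element of $A$ and takes values in $B$ there. Indexing: an indexing of a set $E$ is a partial function $i$ from $\mathbb{N}$ to $E$ such that $dom(i)$ is effectively enumerable, $i$ is surjective, and there is a computable function $eq$ from $dom(i)\times dom(i)$ to $\{0,1\}$ with $eq(x,y)=1$ if $i(x)=i(y)$ and $eq(x,y)=0$ otherwise. An indexing $i$ of the set $E$ is an admissible indexing of a one-sorted structure $\langle E,op_1,\ldots,op_p\rangle$ if every operation $op: E^m\to E$ among $op_1,\ldots,op_p$ is computable relatively to $i$, that is, there is a computable function $\hat{op}$ from $dom(i)^m$ to $dom(i)$ such that $i(\hat{op}(x_1,\ldots,x_m)) = op(i(x_1),\ldots,i(x_m))$ for all $x_1,\ldots,x_m\in dom(i)$. Computability is stable over $\langle E,op_1,\ldots,op_p\rangle$ if there exists an admissible indexing of this structure and, for all admissible indexings $j$ and $j'$ of it, there exists a computable function $h$ from $dom(j')$ to $dom(j)$ such that $j' = j\circ h$. -}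

module Defs where

open import Data.Fin.Base using (Fin)
open import Data.List.Base as List using (List)
open import Data.List.Relation.Unary.All as List using ()
open import Data.Nat.Base using (ℕ; zero; suc; _+_; _<_)
open import Data.Nat.Properties using (<-cmp)
open import Data.Product.Base using (Σ; ∃; _×_; _,_)
open import Data.Sum.Base using (_⊎_)
open import Data.Vec.Base using (Vec; []; _∷_; lookup)
open import Data.Vec.Relation.Binary.Pointwise.Inductive using (Pointwise; []; _∷_)
open import Data.Vec.Relation.Unary.All using (All)
open import Level using (0ℓ)
open import Relation.Binary.Core using (REL; _⇔_)
open import Relation.Binary.Construct.Composition using (_;_)
open import Relation.Binary.Definitions using (tri<; tri≈; tri>)
open import Relation.Binary.PropositionalEquality.Core using (_≡_; _≢_; refl; cong₂)
open import Relation.Binary.Rewriting using (Deterministic)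
open import Relation.Nullary.Negation.Core using (contradiction)
open import Relation.Unary using (Pred; _∈_; _≐_; Empty)

-- A partial function is given by its graph.
record PartialFunction (A B : Set) : Set₁ where
  field
    graph         : REL A B 0ℓ
    deterministic : Deterministic _≡_ graph

  dom : Pred A 0ℓ
  dom x = ∃ λ y → graph x y

open PartialFunction public using (graph; dom)

-- Computability is that of the μ-recursive functions.
data Code : ℕ → Set where
  zeroᶜ : Code 0
  sucᶜ  : Code 1
  proj  : ∀ {m} → Fin m → Code m
  comp  : ∀ {k m} → Code k → Vec (Code m) k → Code m
  prec  : ∀ {m} → Code m → Code (2 + m) → Code (1 + m)
  mu    : ∀ {m} → Code (1 + m) → Code m

infix 4 _[_]⇓_

data _[_]⇓_ : ∀ {m} → Code m → Vec ℕ m → ℕ → Set where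
  ⇓zero : zeroᶜ [ [] ]⇓ 0

  ⇓suc : ∀ {x} → sucᶜ [ x ∷ [] ]⇓ suc x

  ⇓proj : ∀ {m} {i : Fin m} {xs} → proj i [ xs ]⇓ lookup xs i

  ⇓comp : ∀ {k m} {f : Code k} {gs : Vec (Code m) k} {xs ys z} →
          Pointwise (λ g y → g [ xs ]⇓ y) gs ys →
          f [ ys ]⇓ z →
          comp f gs [ xs ]⇓ z

  ⇓prec-zero : ∀ {m} {f : Code m} {g xs y} →
               f [ xs ]⇓ y →
               prec f g [ 0 ∷ xs ]⇓ y

  ⇓prec-suc : ∀ {m} {f : Code m} {g n xs y z} →
              prec f g [ n ∷ xs ]⇓ y →
              g [ n ∷ y ∷ xs ]⇓ z →
              prec f g [ suc n ∷ xs ]⇓ z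

  -- All values below the least zero must be defined and nonzero.
  ⇓mu : ∀ {m} {f : Code (1 + m)} {n xs} →
        f [ n ∷ xs ]⇓ 0 →
        (∀ i → i < n → ∃ λ k → f [ i ∷ xs ]⇓ suc k) →
        mu f [ xs ]⇓ n

⇓-deterministic : ∀ {m} (c : Code m) → Deterministic _≡_ (c [_]⇓_)
⇓-deterministic* : ∀ {k m} (gs : Vec (Code m) k) {xs ys zs} →
                   Pointwise (λ g y → g [ xs ]⇓ y) gs ys →
                   Pointwise (λ g z → g [ xs ]⇓ z) gs zs →
                   ys ≡ zs

⇓-deterministic zeroᶜ ⇓zero ⇓zero = refl
⇓-deterministic sucᶜ ⇓suc ⇓suc = refl
⇓-deterministic (proj i) ⇓proj ⇓proj = refl
⇓-deterministic (comp f gs) (⇓comp ps p) (⇓comp qs q)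
  with refl ← ⇓-deterministic* gs ps qs = ⇓-deterministic f p q
⇓-deterministic (prec f g) (⇓prec-zero p) (⇓prec-zero q) = ⇓-deterministic f p q
⇓-deterministic (prec f g) (⇓prec-suc p p′) (⇓prec-suc q q′)
  with refl ← ⇓-deterministic (prec f g) p q = ⇓-deterministic g p′ q′
⇓-deterministic (mu f) (⇓mu {n = n} p below) (⇓mu {n = n′} q below′) with <-cmp n n′
... | tri≈ _ n≡n′ _ = n≡n′
... | tri< n<n′ _ _ with _ , r ← below′ n n<n′ = contradiction (⇓-deterministic f p r) λ()
... | tri> _ _ n′<n with _ , r ← below n′ n′<n = contradiction (⇓-deterministic f q r) λ()

⇓-deterministic* [] [] [] = refl
⇓-deterministic* (g ∷ gs) (p ∷ ps) (q ∷ qs) =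
  cong₂ _∷_ (⇓-deterministic g p q) (⇓-deterministic* gs ps qs)

⟦_⟧ : ∀ {m} → Code m → PartialFunction (Vec ℕ m) ℕ
⟦ c ⟧ = record { graph = c [_]⇓_ ; deterministic = ⇓-deterministic c }

record ComputableFunction {m} (A : Pred (Vec ℕ m) 0ℓ) (B : Pred ℕ 0ℓ) : Set where
  field
    code    : Code m
    defined : ∀ {xs} → xs ∈ A → xs ∈ dom ⟦ code ⟧
    values  : ∀ {xs y} → xs ∈ A → graph ⟦ code ⟧ xs y → y ∈ B

open ComputableFunction public using (code)

EffectivelyEnumerable : Pred ℕ 0ℓ → Set
EffectivelyEnumerable A =
  Empty A ⊎
  ∃ λ (c : Code 1) →
    (∀ n → n ∷ [] ∈ dom ⟦ c ⟧) ×
    A ≐ (λ x → ∃ λ n → graph ⟦ c ⟧ (n ∷ []) x)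

record IsIndexing {E : Set} (i : PartialFunction ℕ E) : Set where
  field
    enumerable : EffectivelyEnumerable (dom i)
    surjective : ∀ e → ∃ λ x → graph i x e
    eq         : ComputableFunction {2} (All (dom i)) (λ b → b ≡ 0 ⊎ b ≡ 1)
    eq-yes     : ∀ {x y e e′} → graph i x e → graph i y e′ →
                 e ≡ e′ → graph ⟦ code eq ⟧ (x ∷ y ∷ []) 1
    eq-no      : ∀ {x y e e′} → graph i x e → graph i y e′ →
                 e ≢ e′ → graph ⟦ code eq ⟧ (x ∷ y ∷ []) 0

Operation : Set → Set
Operation E = ∃ λ m → Vec E m → E

record Structure : Set₁ where
  constructor ⟨_,_⟩
  field
    Carrier    : Set
    operations : List (Operation Carrier)

open Structure public

ComputableRelativelyTo : {E : Set} → PartialFunction ℕ E → Operation E → Set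
ComputableRelativelyTo i (m , op) =
  Σ (ComputableFunction {m} (All (dom i)) (dom i)) λ ôp →
    ∀ {xs es y} → Pointwise (graph i) xs es →
    graph ⟦ code ôp ⟧ xs y → graph i y (op es)

record IsAdmissibleIndexing (𝔼 : Structure) (i : PartialFunction ℕ (Carrier 𝔼)) : Set where
  field
    isIndexing : IsIndexing i
    computable : List.All (ComputableRelativelyTo i) (operations 𝔼)

-- The equation j′ = j ∘ h is equality of partial functions on ℕ, so h is
-- defined with a value in dom j at exactly the elements of dom j′.
ComputabilityIsStable : Structure → Set₁
ComputabilityIsStable 𝔼 =
  (∃ λ i → IsAdmissibleIndexing 𝔼 i) ×
  (∀ j j′ → IsAdmissibleIndexing 𝔼 j → IsAdmissibleIndexing 𝔼 j′ →
    Σ (ComputableFunction {1} (All (dom j′)) (dom j)) λ h →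
      graph j′ ⇔ ((λ x → graph ⟦ code h ⟧ (x ∷ [])) ; graph j))

successor : Operation ℕ
successor = 1 , λ { (n ∷ []) → suc n }

addition : Operation ℕ
addition = 2 , λ { (m ∷ n ∷ []) → m + n }

{-# OPTIONS --safe #-}
-- An indexing j of ℕ with computable successor ŝ has computable numerals: iterating ŝ on
-- an index of 0 gives, for each k, an index of k.  Given another such indexing j′, the
-- number named by x ∈ dom j′ is the least k for which eq′ identifies x with the numeral
-- of k in j′, and h sends x to the numeral of k in j.  Since eq′ may well converge outside
-- dom j′, h must also be made undefined there, by an unbounded search for x in an
-- enumeration of dom j′.  For addition, ŝ adds an index of 1.
module Submission where

open import Data.Fin.Base using (zero; suc)
open import Data.List.Base using ([_])
import Data.List.Relation.Unary.All as List
open import Data.Nat.Base using (ℕ; zero; suc; pred; _+_; _∸_; _<_)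
open import Data.Nat.Properties
  using (<⇒≢; _≟_; m<1+n⇒m<n∨m≡n; m+n≡0⇒m≡0; m+n≡0⇒n≡0; m∸n≡0⇒m≤n; n∸n≡0;
         pred[m∸n]≡m∸[1+n]; ≤-antisym)
open import Data.Product.Base using (∃; Σ; _×_; _,_; proj₁; proj₂)
open import Data.Sum.Base using (_⊎_; inj₁; inj₂)
open import Data.Vec.Base using (Vec; []; _∷_)
open import Data.Vec.Relation.Binary.Pointwise.Inductive using ([]; _∷_)
open import Data.Vec.Relation.Unary.All using (All; []; _∷_)
open import Level using (0ℓ)
open import Relation.Binary.Core using (_⇔_)
open import Relation.Binary.Construct.Composition using (_;_)
open import Relation.Binary.PropositionalEquality
  using (_≡_; _≢_; refl; sym; trans; cong₂; subst; ≢-sym)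
open import Relation.Nullary.Decidable.Core using (yes; no)
open import Relation.Nullary.Negation.Core using (contradiction)
open import Relation.Unary using (Pred; _∈_; _≐_)

open import Defs

constᶜ : ∀ {m} → ℕ → Code m
constᶜ zero    = comp zeroᶜ []
constᶜ (suc n) = comp sucᶜ (constᶜ n ∷ [])

constᶜ-⇓ : ∀ {m} {xs : Vec ℕ m} n → constᶜ n [ xs ]⇓ n
constᶜ-⇓ zero    = ⇓comp [] ⇓zero
constᶜ-⇓ (suc n) = ⇓comp (constᶜ-⇓ n ∷ []) ⇓suc

predᶜ : Code 1
predᶜ = prec zeroᶜ (proj zero)

predᶜ-⇓ : ∀ n → predᶜ [ n ∷ [] ]⇓ pred n
predᶜ-⇓ zero    = ⇓prec-zero ⇓zero
predᶜ-⇓ (suc n) = ⇓prec-suc (predᶜ-⇓ n) ⇓proj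

isZeroᶜ : Code 1
isZeroᶜ = prec (constᶜ 1) (constᶜ 0)

isZeroᶜ-zero : isZeroᶜ [ 0 ∷ [] ]⇓ 1
isZeroᶜ-zero = ⇓prec-zero (constᶜ-⇓ 1)

isZeroᶜ-suc : ∀ n → isZeroᶜ [ suc n ∷ [] ]⇓ 0
isZeroᶜ-suc zero    = ⇓prec-suc isZeroᶜ-zero (constᶜ-⇓ 0)
isZeroᶜ-suc (suc n) = ⇓prec-suc (isZeroᶜ-suc n) (constᶜ-⇓ 0)

addᶜ : Code 2
addᶜ = prec (proj zero) (comp sucᶜ (proj (suc zero) ∷ []))

addᶜ-⇓ : ∀ m n → addᶜ [ m ∷ n ∷ [] ]⇓ m + n
addᶜ-⇓ zero    n = ⇓prec-zero ⇓proj
addᶜ-⇓ (suc m) n = ⇓prec-suc (addᶜ-⇓ m n) (⇓comp (⇓proj ∷ []) ⇓suc)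

-- The subtrahend is the first argument, as the recursion is on it.
monusᶜ : Code 2
monusᶜ = prec (proj zero) (comp predᶜ (proj (suc zero) ∷ []))

monusᶜ-⇓ : ∀ n m → monusᶜ [ n ∷ m ∷ [] ]⇓ m ∸ n
monusᶜ-⇓ zero    m = ⇓prec-zero ⇓proj
monusᶜ-⇓ (suc n) m = subst (monusᶜ [ suc n ∷ m ∷ [] ]⇓_) (pred[m∸n]≡m∸[1+n] m n)
  (⇓prec-suc (monusᶜ-⇓ n m) (⇓comp (⇓proj ∷ []) (predᶜ-⇓ (m ∸ n))))

distance : ℕ → ℕ → ℕ
distance m n = (n ∸ m) + (m ∸ n)

distance-refl : ∀ n → distance n n ≡ 0
distance-refl n = cong₂ _+_ (n∸n≡0 n) (n∸n≡0 n)

distance≡0⇒≡ : ∀ m n → distance m n ≡ 0 → m ≡ n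
distance≡0⇒≡ m n d≡0 =
  ≤-antisym (m∸n≡0⇒m≤n (m+n≡0⇒n≡0 (n ∸ m) d≡0)) (m∸n≡0⇒m≤n (m+n≡0⇒m≡0 (n ∸ m) d≡0))

distanceᶜ : Code 2
distanceᶜ = comp addᶜ (monusᶜ ∷ comp monusᶜ (proj (suc zero) ∷ proj zero ∷ []) ∷ [])

distanceᶜ-⇓ : ∀ m n → distanceᶜ [ m ∷ n ∷ [] ]⇓ distance m n
distanceᶜ-⇓ m n =
  ⇓comp (monusᶜ-⇓ m n ∷ ⇓comp (⇓proj ∷ ⇓proj ∷ []) (monusᶜ-⇓ n m) ∷ []) (addᶜ-⇓ (n ∸ m) (m ∸ n))

equalᶜ : Code 2
equalᶜ = comp isZeroᶜ (distanceᶜ ∷ [])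

equalᶜ-refl : ∀ n → equalᶜ [ n ∷ n ∷ [] ]⇓ 1
equalᶜ-refl n = ⇓comp
  (subst (distanceᶜ [ n ∷ n ∷ [] ]⇓_) (distance-refl n) (distanceᶜ-⇓ n n) ∷ []) isZeroᶜ-zero

equalᶜ-≢ : ∀ {m n} → m ≢ n → equalᶜ [ m ∷ n ∷ [] ]⇓ 0
equalᶜ-≢ {m} {n} m≢n with distance m n in d≡ | distanceᶜ-⇓ m n
... | zero  | _ = contradiction (distance≡0⇒≡ m n d≡) m≢n
... | suc d | p = ⇓comp (p ∷ []) (isZeroᶜ-suc d)

mu-defined : ∀ {m} {f : Code (1 + m)} {xs n} →
             (∀ i → i ∷ xs ∈ dom ⟦ f ⟧) → f [ n ∷ xs ]⇓ 0 → xs ∈ dom ⟦ mu f ⟧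
mu-defined {f = f} {xs} {n} total f⇓0 with search n
  where
  search : ∀ k → xs ∈ dom ⟦ mu f ⟧ ⊎ (∀ i → i < k → ∃ λ y → f [ i ∷ xs ]⇓ suc y)
  search zero = inj₂ λ _ ()
  search (suc k) with search k
  ... | inj₁ found = inj₁ found
  ... | inj₂ below with total k
  ... | zero  , p = inj₁ (k , ⇓mu p below)
  ... | suc y , p = inj₂ λ i i<1+k → extend i (m<1+n⇒m<n∨m≡n i<1+k)
    where
    extend : ∀ i → i < k ⊎ i ≡ k → ∃ λ y → f [ i ∷ xs ]⇓ suc y
    extend i (inj₁ i<k)  = below i i<k
    extend i (inj₂ refl) = y , p
... | inj₁ found = found
... | inj₂ below = n , ⇓mu f⇓0 below

enumerable⇒semidecidable :
  ∀ {A : Pred ℕ 0ℓ} → EffectivelyEnumerable A → ∃ A →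
  ∃ λ (c : Code 1) → A ≐ (λ x → x ∷ [] ∈ dom ⟦ c ⟧)
enumerable⇒semidecidable (inj₁ empty) (x , x∈A) = contradiction x∈A (empty x)
enumerable⇒semidecidable {A} (inj₂ (e , total , A⊆ , ⊆A)) _ = mu test , found , sound
  where
  test : Code 2
  test = comp distanceᶜ (comp e (proj zero ∷ []) ∷ proj (suc zero) ∷ [])

  test-⇓ : ∀ {n x y} → e [ n ∷ [] ]⇓ y → test [ n ∷ x ∷ [] ]⇓ distance y x
  test-⇓ {x = x} {y} p = ⇓comp (⇓comp (⇓proj ∷ []) p ∷ ⇓proj ∷ []) (distanceᶜ-⇓ y x)

  found : ∀ {x} → x ∈ A → x ∷ [] ∈ dom ⟦ mu test ⟧
  found {x} x∈A with A⊆ x∈A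
  ... | n , p = mu-defined (λ i → _ , test-⇓ (proj₂ (total i)))
                           (subst (test [ n ∷ x ∷ [] ]⇓_) (distance-refl x) (test-⇓ p))

  sound : ∀ {x} → x ∷ [] ∈ dom ⟦ mu test ⟧ → x ∈ A
  sound {x} (n , ⇓mu p _) with total n
  ... | y , q with refl ← distance≡0⇒≡ y x (⇓-deterministic test (test-⇓ q) p) = ⊆A (n , q)

identity : PartialFunction ℕ ℕ
identity = record { graph = _≡_ ; deterministic = λ p q → trans (sym p) q }

identity-isIndexing : IsIndexing identity
identity-isIndexing = record
  { enumerable = inj₂ (proj zero , (λ n → n , ⇓proj) , (λ {x} _ → x , ⇓proj) , λ {x} _ → x , refl)
  ; surjective = λ e → e , refl
  ; eq         = record
    { code    = equalᶜ
    ; defined = λ { {x ∷ y ∷ []} _ → _ , ⇓comp (distanceᶜ-⇓ x y ∷ []) (proj₂ (isZeroᶜ-defined _)) }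
    ; values  = λ { {x ∷ y ∷ []} _ p → boolean x y p }
    }
  ; eq-yes     = λ { {x} refl refl refl → equalᶜ-refl x }
  ; eq-no      = λ { refl refl x≢y → equalᶜ-≢ x≢y }
  }
  where
  isZeroᶜ-defined : ∀ n → n ∷ [] ∈ dom ⟦ isZeroᶜ ⟧
  isZeroᶜ-defined zero    = 1 , isZeroᶜ-zero
  isZeroᶜ-defined (suc n) = 0 , isZeroᶜ-suc n

  boolean : ∀ x y {b} → equalᶜ [ x ∷ y ∷ [] ]⇓ b → b ≡ 0 ⊎ b ≡ 1
  boolean x y p with x ≟ y
  ... | yes refl = inj₂ (⇓-deterministic equalᶜ p (equalᶜ-refl x))
  ... | no x≢y   = inj₁ (⇓-deterministic equalᶜ p (equalᶜ-≢ x≢y))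

identity-successor : IsAdmissibleIndexing ⟨ ℕ , [ successor ] ⟩ identity
identity-successor = record
  { isIndexing = identity-isIndexing
  ; computable = (record
      { code    = sucᶜ
      ; defined = λ { {_ ∷ []} _ → _ , ⇓suc }
      ; values  = λ _ _ → _ , refl
      } , λ { (refl ∷ []) ⇓suc → refl }) List.∷ List.[]
  }

identity-addition : IsAdmissibleIndexing ⟨ ℕ , [ addition ] ⟩ identity
identity-addition = record
  { isIndexing = identity-isIndexing
  ; computable = (record
      { code    = addᶜ
      ; defined = λ { {m ∷ n ∷ []} _ → _ , addᶜ-⇓ m n }
      ; values  = λ _ _ → _ , refl
      } , λ { {m ∷ n ∷ []} (refl ∷ refl ∷ []) p → ⇓-deterministic addᶜ p (addᶜ-⇓ m n) })
      List.∷ List.[]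
  }

addition⇒successor : ∀ {j} → IsAdmissibleIndexing ⟨ ℕ , [ addition ] ⟩ j →
                     IsAdmissibleIndexing ⟨ ℕ , [ successor ] ⟩ j
addition⇒successor {j} record { isIndexing = isIndexing ; computable = (add , tracks) List.∷ List.[] } =
  record
  { isIndexing = isIndexing
  ; computable = (record
      { code    = ŝ
      ; defined = λ { {_ ∷ []} ((_ , jx) ∷ []) → let y , p , _ = ŝ-⇓ jx in y , p }
      ; values  = λ { {_ ∷ []} ((_ , jx) ∷ []) p → _ , ŝ-tracks jx p }
      } , λ { (jx ∷ []) p → ŝ-tracks jx p }) List.∷ List.[]
  }
  where
  open IsIndexing isIndexing

  one : ℕ
  one = proj₁ (surjective 1)

  ŝ : Code 1
  ŝ = comp (code add) (constᶜ one ∷ proj zero ∷ [])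

  ŝ-⇓ : ∀ {x e} → graph j x e → ∃ λ y → ŝ [ x ∷ [] ]⇓ y × graph j y (suc e)
  ŝ-⇓ jx with j1 ← proj₂ (surjective 1)
    with y , p ← ComputableFunction.defined add ((_ , j1) ∷ (_ , jx) ∷ []) =
    y , ⇓comp (constᶜ-⇓ one ∷ ⇓proj ∷ []) p , tracks (j1 ∷ jx ∷ []) p

  ŝ-tracks : ∀ {x e y} → graph j x e → ŝ [ x ∷ [] ]⇓ y → graph j y (suc e)
  ŝ-tracks jx p with y , q , jy ← ŝ-⇓ jx with refl ← ⇓-deterministic ŝ p q = jy

numerals : ∀ {j} → IsAdmissibleIndexing ⟨ ℕ , [ successor ] ⟩ j →
           ∃ λ (c : Code 1) → ∀ k → ∃ λ y → c [ k ∷ [] ]⇓ y × graph j y k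
numerals {j} record { isIndexing = isIndexing ; computable = (ŝ , tracks) List.∷ List.[] } =
  numeralᶜ , numeralᶜ-⇓
  where
  open IsIndexing isIndexing

  numeralᶜ : Code 1
  numeralᶜ = prec (constᶜ (proj₁ (surjective 0))) (comp (code ŝ) (proj (suc zero) ∷ []))

  numeralᶜ-⇓ : ∀ k → ∃ λ y → numeralᶜ [ k ∷ [] ]⇓ y × graph j y k
  numeralᶜ-⇓ zero = _ , ⇓prec-zero (constᶜ-⇓ _) , proj₂ (surjective 0)
  numeralᶜ-⇓ (suc k) with y , p , jy ← numeralᶜ-⇓ k
    with z , q ← ComputableFunction.defined ŝ ((_ , jy) ∷ []) =
    z , ⇓prec-suc p (⇓comp (⇓proj ∷ []) q) , tracks (jy ∷ []) q

decoding : ∀ {j} → IsAdmissibleIndexing ⟨ ℕ , [ successor ] ⟩ j →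
           ∃ λ (c : Code 1) → ∀ {x e} → graph j x e → c [ x ∷ [] ]⇓ e
decoding {j} adm = mu test , λ {x} {e} jx → ⇓mu (test-≡ jx) λ i i<e → 0 , test-≢ jx (<⇒≢ i<e)
  where
  open IsIndexing (IsAdmissibleIndexing.isIndexing adm)

  numeralᶜ : Code 1
  numeralᶜ = proj₁ (numerals adm)

  test : Code 2
  test = comp isZeroᶜ (comp (code eq) (proj (suc zero) ∷ comp numeralᶜ (proj zero ∷ []) ∷ []) ∷ [])

  test-≡ : ∀ {x e} → graph j x e → test [ e ∷ x ∷ [] ]⇓ 0
  test-≡ {e = e} jx with y , p , jy ← proj₂ (numerals adm) e =
    ⇓comp (⇓comp (⇓proj ∷ ⇓comp (⇓proj ∷ []) p ∷ []) (eq-yes jx jy refl) ∷ []) (isZeroᶜ-suc 0)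

  test-≢ : ∀ {x e k} → graph j x e → k ≢ e → test [ k ∷ x ∷ [] ]⇓ 1
  test-≢ {k = k} jx k≢e with y , p , jy ← proj₂ (numerals adm) k =
    ⇓comp (⇓comp (⇓proj ∷ ⇓comp (⇓proj ∷ []) p ∷ []) (eq-no jx jy (≢-sym k≢e)) ∷ []) isZeroᶜ-zero

translation : ∀ j j′ → IsAdmissibleIndexing ⟨ ℕ , [ successor ] ⟩ j →
              IsAdmissibleIndexing ⟨ ℕ , [ successor ] ⟩ j′ →
              Σ (ComputableFunction {1} (All (dom j′)) (dom j)) λ h →
                graph j′ ⇔ ((λ x → graph ⟦ code h ⟧ (x ∷ [])) ; graph j)
translation j j′ adm adm′ =
  record
    { code    = h
    ; defined = λ { {_ ∷ []} ((_ , j′x) ∷ []) → let y , p , _ = h-⇓ j′x in y , p }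
    ; values  = λ { {_ ∷ []} ((_ , j′x) ∷ []) p → _ , h-tracks j′x p }
    } ,
  h-⇓ , λ (_ , p , jy) → h-reflects p jy
  where
  open IsIndexing (IsAdmissibleIndexing.isIndexing adm′) using (enumerable; surjective)

  numeralᶜ : Code 1
  numeralᶜ = proj₁ (numerals adm)

  decodeᶜ : Code 1
  decodeᶜ = proj₁ (decoding adm′)

  dom-semidecidable : ∃ λ (c : Code 1) → dom j′ ≐ (λ x → x ∷ [] ∈ dom ⟦ c ⟧)
  dom-semidecidable = enumerable⇒semidecidable enumerable (_ , _ , proj₂ (surjective 0))

  domᶜ : Code 1
  domᶜ = proj₁ dom-semidecidable

  -- The value of domᶜ is discarded: it only restricts the domain.
  h : Code 1
  h = comp (proj zero) (comp numeralᶜ (decodeᶜ ∷ []) ∷ domᶜ ∷ [])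

  h-⇓ : ∀ {x e} → graph j′ x e → ∃ λ y → h [ x ∷ [] ]⇓ y × graph j y e
  h-⇓ {e = e} j′x with y , p , jy ← proj₂ (numerals adm) e
    with _ , q ← proj₁ (proj₂ dom-semidecidable) (_ , j′x) =
    y , ⇓comp (⇓comp (proj₂ (decoding adm′) j′x ∷ []) p ∷ q ∷ []) ⇓proj , jy

  h-tracks : ∀ {x e y} → graph j′ x e → h [ x ∷ [] ]⇓ y → graph j y e
  h-tracks j′x p with _ , q , jy ← h-⇓ j′x with refl ← ⇓-deterministic h p q = jy

  h-reflects : ∀ {x e y} → h [ x ∷ [] ]⇓ y → graph j y e → graph j′ x e
  h-reflects p@(⇓comp (_ ∷ q ∷ []) _) jy
    with _ , j′x ← proj₂ (proj₂ dom-semidecidable) (_ , q)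
    with refl ← PartialFunction.deterministic j (h-tracks j′x p) jy = j′x

proposition4 : ComputabilityIsStable ⟨ ℕ , [ successor ] ⟩ × ComputabilityIsStable ⟨ ℕ , [ addition ] ⟩
proposition4 =
  ((identity , identity-successor) , translation) ,
  ((identity , identity-addition) ,
   λ j j′ adm adm′ → translation j j′ (addition⇒successor adm) (addition⇒successor adm′))
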